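{- The relation $\stackrel{\curlywedge}{\approx}_\alpha$ coincides with $\approx_\alpha$ on ground terms: for all ground nominal terms $s,t$ (terms without variables), $\emptyset\vdash s\approx_\alpha t$ if and only if $\emptyset\vdash s\stackrel{\curlywedge}{\approx}_\alpha t$. More generally, for all nominal terms $s,t$: (1) for every freshness context $\Delta$, if $\Delta\vdash s\approx_\alpha t$ then $[\Delta]_{\curlywedge}\vdash s\stackrel{\curlywedge}{\approx}_\alpha t$; (2) for every fixed-point context $\Upsilon$ and every list $\overline c$ of newly quantified atoms, if $\Upsilon\vdash\mathsf{N}\overline c.\,s\stackrel{\curlywedge}{\approx}_\alpha t$ then $[\Upsilon]_{\#}\cup\Delta\vdash s\approx_\alpha t$ for any freshness context $\Delta$ such that $\Delta\vdash c\# X$ for every $c\in\overline c$ and every variable $X$ occurring in $s$ or $t$.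
   Context: **Syntax.** Fix a countably infinite set $\mathbb{A}$ of atoms $a,b,c,\dots$ (distinct letters denote distinct atoms), a countably infinite set of variables $X,Y,\dots$, and a countable set of function symbols. A permutation is a bijection $\pi:\mathbb{A}\to\mathbb{A}$ with $\mathrm{supp}(\pi)=\{a\mid\pi(a)\neq a\}$ finite; $(a\ b)$ is a swapping. Nominal terms: $s,t::=a\mid[a]t\mid(t_1,\dots,t_n)\mid f\,t\mid\pi\cdot X$ (not quotiented by $\alpha$-renaming; $X$ abbreviates $Id\cdot X$). Permutation action: $\pi\cdot a=\pi(a)$, $\pi\cdot[a]t=[\pi(a)](\pi\cdot t)$, $\pi\cdot(\pi'\cdot X)=(\pi\circ\pi')\cdot X$, and componentwise on tuples and applications. Conjugate: $\pi^{\rho}=\rho\circ\pi\circ\rho^{ -1}$. **Freshness approach.** A freshness context $\Delta$ is a finite set of constraints $a\# X$. Rules for $\Delta\vdash a\# t$: $\Delta\vdash a\# b$ for $a\neq b$; $\Delta\vdash a\#\pi\cdot X$ if $\pi^{ -1}(a)\# X\in\Delta$; $\Delta\vdash a\# f\,t$ if $\Delta\vdash a\# t$; $\Delta\vdash a\#(t_1,\dots,t_n)$ if $\Delta\vdash a\# t_i$ for all $i$; $\Delta\vdash a\#[a]t$; $\Delta\vdash a\#[b]t$ if $a\ne b$ and $\Delta\vdash a\# t$. Rules for $\Delta\vdash s\approx_\alpha t$: $\Delta\vdash a\approx_\alpha a$; $\Delta\vdash\pi\cdot X\approx_\alpha\pi'\cdot X$ if $a\# X\in\Delta$ for every $a$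 with $\pi(a)\neq\pi'(a)$; congruence for $f$ and for tuples of the same length; from $\Delta\vdash t\approx_\alpha t'$ infer $\Delta\vdash[a]t\approx_\alpha[a]t'$; from $\Delta\vdash s\approx_\alpha(a\ b)\cdot t$ and $\Delta\vdash a\# t$ infer $\Delta\vdash[a]s\approx_\alpha[b]t$ ($a\neq b$). **Fixed-point approach.** A fixed-point context $\Upsilon$ is a finite set of constraints $\pi\curlywedge X$. Put $\mathrm{supp}(\mathrm{perm}(\Upsilon|_X))=\bigcup\{\mathrm{supp}(\pi)\mid\pi\curlywedge X\in\Upsilon\}$. In judgements, $\overline c$ is a finite, possibly empty, list of newly quantified atoms ($\mathsf N$ is the nominal "new" quantifier, omitted when $\overline c$ is empty). Rules for $\Upsilon\vdash\mathsf{N}\overline c.\,\pi\curlywedge t$: - $\Upsilon\vdash\mathsf{N}\overline c.\,\pi\curlywedge a$ if $\pi(a)=a$; - $\Upsilon\vdash\mathsf{N}\overline c.\,\pi\curlywedge\pi'\cdot X$ if $\mathrm{supp}(\pi^{\pi'^{ -1}})\setminus\{\overline c\}\subseteq\mathrm{supp}(\mathrm{perm}(\Upsilon|_X))$; - from $\Upsilon\vdash\mathsf{N}\overline c.\,\pi\curlywedge t$ infer $\Upsilon\vdash\mathsf{N}\overline c.\,\pi\curlywedge f\,t$; - from $\Upsilon\vdash\mathsf{N}\overline c.\,\pi\curlywedge t_i$ for all $i$ infer $\Upsilon\vdash\mathsf{N}\overline c.\,\pi\curlywedge(t_1,\dots,t_n)$; - from $\Upsilon\vdash\mathsf{N}\overline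 c,c_1.\,\pi\curlywedge(a\ c_1)\cdot t$ infer $\Upsilon\vdash\mathsf{N}\overline c.\,\pi\curlywedge[a]t$, with $c_1$ a new atom not occurring in the conclusion. Rules for $\Upsilon\vdash\mathsf{N}\overline c.\,s\stackrel{\curlywedge}{\approx}_\alpha t$: - $\Upsilon\vdash\mathsf{N}\overline c.\,a\stackrel{\curlywedge}{\approx}_\alpha a$; - $\Upsilon\vdash\mathsf{N}\overline c.\,\pi\cdot X\stackrel{\curlywedge}{\approx}_\alpha\pi'\cdot X$ if $\mathrm{supp}((\pi')^{ -1}\circ\pi)\setminus\{\overline c\}\subseteq\mathrm{supp}(\mathrm{perm}(\Upsilon|_X))$; - congruence (same $\overline c$) for $f$, for tuples of the same length, and for abstractions $[a]t,[a]t'$ of the same atom; - from $\Upsilon\vdash\mathsf{N}\overline c.\,s\stackrel{\curlywedge}{\approx}_\alpha(a\ b)\cdot t$ and $\Upsilon\vdash\mathsf{N}\overline c,c_1.\,(a\ c_1)\curlywedge t$ infer $\Upsilon\vdash\mathsf{N}\overline c.\,[a]s\stackrel{\curlywedge}{\approx}_\alpha[b]t$ ($a\neq b$, $c_1$ a new atom not occurring in the conclusion). **Translations.** $[\Delta]_{\curlywedge}=\{(a\ c_a)\curlywedge X\mid a\# X\in\Delta\}$ where each $c_a$ is a new atom (occurring nowhere else in the judgements considered). $[\Upsilon]_{\#}=\{a\# X\mid \pi\curlywedge X\in\Upsilon,\ a\in\mathrm{supp}(\pi)\}$. -}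

module Defs where

open import Data.Empty using (⊥-elim)
open import Data.Fin.Base using (Fin)
open import Data.List.Base using (List; []; _∷_; _++_; map; filter; concatMap)
open import Data.List.Membership.Propositional using (_∈_; _∉_)
open import Data.List.Membership.Propositional.Properties using (∈-++⁺ˡ; ∈-++⁺ʳ)
open import Data.List.Relation.Unary.Any using (here; there)
open import Data.Nat.Base using (ℕ)
open import Data.Nat.Properties using (_≟_)
open import Data.Product.Base using (_×_; _,_; ∃-syntax)
open import Data.Vec.Functional using (Vector)
open import Function.Bundles using (_↔_; mk↔ₛ′; Inverse)
open import Function.Construct.Composition using (_↔-∘_)
open import Function.Construct.Identity using (↔-id)
open import Function.Construct.Symmetry using (↔-sym)
open import Level using (0ℓ)
open import Relation.Binary.PropositionalEquality using (_≡_; _≢_; refl; sym; trans; cong)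
open import Relation.Nullary using (¬_; yes; no)
open import Relation.Nullary.Decidable using (¬?)
open import Relation.Unary using (Pred; _⊆_; _∖_)

Atom : Set
Atom = ℕ

Var : Set
Var = ℕ

-- `bound` may list more atoms than the support; it only witnesses finiteness.
-- The support itself is the predicate `supp` below.
record Perm : Set where
  field
    bij     : Atom ↔ Atom
    bound   : List Atom
    bounded : ∀ a → Inverse.to bij a ≢ a → a ∈ bound

open Perm public

infixr 20 _⟨$⟩_
_⟨$⟩_ : Perm → Atom → Atom
π ⟨$⟩ a = Inverse.to (bij π) a

supp : Perm → Pred Atom 0ℓ
supp π a = π ⟨$⟩ a ≢ a

idₚ : Perm
idₚ = record
  { bij     = ↔-id Atom
  ; bound   = []
  ; bounded = λ _ a≢a → ⊥-elim (a≢a refl)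
  }

infix 30 _⁻¹
_⁻¹ : Perm → Perm
π ⁻¹ = record
  { bij     = ↔-sym (bij π)
  ; bound   = bound π
  ; bounded = λ a ne → bounded π a λ eq →
      ne (trans (cong (Inverse.from (bij π)) (sym eq))
                (Inverse.strictlyInverseʳ (bij π) a))
  }

infixr 25 _∘ₚ_
_∘ₚ_ : Perm → Perm → Perm
π ∘ₚ ρ = record
  { bij     = bij π ↔-∘ bij ρ
  ; bound   = bound π ++ bound ρ
  ; bounded = bd
  }
  where
  bd : ∀ a → π ⟨$⟩ ρ ⟨$⟩ a ≢ a → a ∈ bound π ++ bound ρ
  bd a ne with ρ ⟨$⟩ a ≟ a
  ... | no  ρa≢a = ∈-++⁺ʳ (bound π) (bounded ρ a ρa≢a)
  ... | yes ρa≡a = ∈-++⁺ˡ (bounded π a λ πa≡a →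
                     ne (trans (cong (π ⟨$⟩_) ρa≡a) πa≡a))

infix 28 _^_
_^_ : Perm → Perm → Perm
π ^ ρ = ρ ∘ₚ π ∘ₚ ρ ⁻¹

swapFun : Atom → Atom → Atom → Atom
swapFun a b c with c ≟ a
... | yes _ = b
... | no  _ with c ≟ b
...   | yes _ = a
...   | no  _ = c

swapFun-involutive : ∀ a b c → swapFun a b (swapFun a b c) ≡ c
swapFun-involutive a b c with c ≟ a
swapFun-involutive a b c | yes c≡a with b ≟ a
... | yes b≡a = trans b≡a (sym c≡a)
... | no  _ with b ≟ b
...   | yes _   = sym c≡a
...   | no  b≢b = ⊥-elim (b≢b refl)
swapFun-involutive a b c | no c≢a with c ≟ b
swapFun-involutive a b c | no c≢a | yes c≡b with a ≟ a
... | yes _   = sym c≡b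
... | no  a≢a = ⊥-elim (a≢a refl)
swapFun-involutive a b c | no c≢a | no c≢b with c ≟ a
... | yes c≡a = ⊥-elim (c≢a c≡a)
... | no  _ with c ≟ b
...   | yes c≡b = ⊥-elim (c≢b c≡b)
...   | no  _   = refl

swapFun-bounded : ∀ a b c → swapFun a b c ≢ c → c ∈ a ∷ b ∷ []
swapFun-bounded a b c ne with c ≟ a
... | yes c≡a = here c≡a
... | no  _ with c ≟ b
...   | yes c≡b = there (here c≡b)
...   | no  _   = ⊥-elim (ne refl)

swap : Atom → Atom → Perm
swap a b = record
  { bij     = mk↔ₛ′ (swapFun a b) (swapFun a b)
                    (swapFun-involutive a b) (swapFun-involutive a b)
  ; bound   = a ∷ b ∷ []
  ; bounded = swapFun-bounded a b
  }

infix  16 _·_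
infixr 15 [_]_

data Term (F : Set) : Set where
  atom  : Atom → Term F
  [_]_  : Atom → Term F → Term F
  tuple : ∀ {n} → Vector (Term F) n → Term F
  app   : F → Term F → Term F
  _·_   : Perm → Var → Term F

var : ∀ {F} → Var → Term F
var X = idₚ · X

infixr 15 _•_
_•_ : ∀ {F} → Perm → Term F → Term F
π • atom a    = atom (π ⟨$⟩ a)
π • ([ a ] t) = [ π ⟨$⟩ a ] (π • t)
π • tuple ts  = tuple λ i → π • ts i
π • app f t   = app f (π • t)
π • (ρ · X)   = (π ∘ₚ ρ) · X

-- The atoms occurring in π · X are those of supp π.
infix 4 _occursIn_
data _occursIn_ {F : Set} (c : Atom) : Term F → Set where
  in-atom  : c occursIn atom c
  in-bind  : ∀ {t} → c occursIn [ c ] t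
  in-body  : ∀ {a t} → c occursIn t → c occursIn [ a ] t
  in-tuple : ∀ {n} {ts : Vector (Term F) n} (i : Fin n) → c occursIn ts i → c occursIn tuple ts
  in-app   : ∀ {f t} → c occursIn t → c occursIn app f t
  in-susp  : ∀ {π X} → supp π c → c occursIn π · X

infix 4 _varOf_
data _varOf_ {F : Set} (X : Var) : Term F → Set where
  in-body  : ∀ {a t} → X varOf t → X varOf [ a ] t
  in-tuple : ∀ {n} {ts : Vector (Term F) n} (i : Fin n) → X varOf ts i → X varOf tuple ts
  in-app   : ∀ {f t} → X varOf t → X varOf app f t
  in-susp  : ∀ {π} → X varOf π · X

Ground : ∀ {F} → Term F → Set
Ground t = ∀ X → ¬ (X varOf t)

-- Contexts are finite sets, represented by lists and used only through
-- membership: (a , X) stands for a # X, and (π , X) for π ⋏ X.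
FreshCtx : Set
FreshCtx = List (Atom × Var)

FixCtx : Set
FixCtx = List (Perm × Var)

occursInΔ : FreshCtx → Pred Atom 0ℓ
occursInΔ Δ a = ∃[ X ] (a , X) ∈ Δ

occursInΥ : FixCtx → Pred Atom 0ℓ
occursInΥ Υ a = ∃[ π ] ∃[ X ] (π , X) ∈ Υ × supp π a

infix 4 _⊢_#_ _⊢_≈α_

data _⊢_#_ {F : Set} (Δ : FreshCtx) (a : Atom) : Term F → Set where
  #-atom  : ∀ {b} → a ≢ b → Δ ⊢ a # atom b
  #-susp  : ∀ {π X} → (π ⁻¹ ⟨$⟩ a , X) ∈ Δ → Δ ⊢ a # π · X
  #-app   : ∀ {f t} → Δ ⊢ a # t → Δ ⊢ a # app f t
  #-tuple : ∀ {n} {ts : Vector (Term F) n} → (∀ i → Δ ⊢ a # ts i) → Δ ⊢ a # tuple ts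
  #-abs≡  : ∀ {t} → Δ ⊢ a # [ a ] t
  #-abs≢  : ∀ {b t} → a ≢ b → Δ ⊢ a # t → Δ ⊢ a # [ b ] t

data _⊢_≈α_ {F : Set} (Δ : FreshCtx) : Term F → Term F → Set where
  ≈-atom  : ∀ {a} → Δ ⊢ atom a ≈α atom a
  ≈-susp  : ∀ {π π′ X} → (∀ a → π ⟨$⟩ a ≢ π′ ⟨$⟩ a → (a , X) ∈ Δ) → Δ ⊢ π · X ≈α π′ · X
  ≈-app   : ∀ {f t t′} → Δ ⊢ t ≈α t′ → Δ ⊢ app f t ≈α app f t′
  ≈-tuple : ∀ {n} {ts ts′ : Vector (Term F) n} →
            (∀ i → Δ ⊢ ts i ≈α ts′ i) → Δ ⊢ tuple ts ≈α tuple ts′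
  ≈-abs≡  : ∀ {a t t′} → Δ ⊢ t ≈α t′ → Δ ⊢ [ a ] t ≈α [ a ] t′
  ≈-abs≢  : ∀ {a b s t} → a ≢ b →
            Δ ⊢ s ≈α swap a b • t → Δ ⊢ a # t → Δ ⊢ [ a ] s ≈α [ b ] t

suppPerm : FixCtx → Var → Pred Atom 0ℓ
suppPerm Υ X a = ∃[ π ] (π , X) ∈ Υ × supp π a

infix 4 _⊢И⟨_⟩_⋏_ _⊢И⟨_⟩_≈⋏_

data _⊢И⟨_⟩_⋏_ {F : Set} (Υ : FixCtx) (cs : List Atom) (π : Perm) : Term F → Set where
  ⋏-atom  : ∀ {a} → π ⟨$⟩ a ≡ a → Υ ⊢И⟨ cs ⟩ π ⋏ atom a
  ⋏-susp  : ∀ {π′ X} → supp (π ^ (π′ ⁻¹)) ∖ (_∈ cs) ⊆ suppPerm Υ X → Υ ⊢И⟨ cs ⟩ π ⋏ π′ · X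
  ⋏-app   : ∀ {f t} → Υ ⊢И⟨ cs ⟩ π ⋏ t → Υ ⊢И⟨ cs ⟩ π ⋏ app f t
  ⋏-tuple : ∀ {n} {ts : Vector (Term F) n} →
            (∀ i → Υ ⊢И⟨ cs ⟩ π ⋏ ts i) → Υ ⊢И⟨ cs ⟩ π ⋏ tuple ts
  ⋏-abs   : ∀ {a t} (c₁ : Atom) →
            ¬ occursInΥ Υ c₁ → c₁ ∉ cs → ¬ supp π c₁ → ¬ (c₁ occursIn [ a ] t) →
            Υ ⊢И⟨ c₁ ∷ cs ⟩ π ⋏ (swap a c₁ • t) → Υ ⊢И⟨ cs ⟩ π ⋏ [ a ] t

data _⊢И⟨_⟩_≈⋏_ {F : Set} (Υ : FixCtx) (cs : List Atom) : Term F → Term F → Set where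
  ≈-atom  : ∀ {a} → Υ ⊢И⟨ cs ⟩ atom a ≈⋏ atom a
  ≈-susp  : ∀ {π π′ X} → supp (π′ ⁻¹ ∘ₚ π) ∖ (_∈ cs) ⊆ suppPerm Υ X →
            Υ ⊢И⟨ cs ⟩ π · X ≈⋏ π′ · X
  ≈-app   : ∀ {f t t′} → Υ ⊢И⟨ cs ⟩ t ≈⋏ t′ → Υ ⊢И⟨ cs ⟩ app f t ≈⋏ app f t′
  ≈-tuple : ∀ {n} {ts ts′ : Vector (Term F) n} →
            (∀ i → Υ ⊢И⟨ cs ⟩ ts i ≈⋏ ts′ i) → Υ ⊢И⟨ cs ⟩ tuple ts ≈⋏ tuple ts′
  ≈-abs≡  : ∀ {a t t′} → Υ ⊢И⟨ cs ⟩ t ≈⋏ t′ → Υ ⊢И⟨ cs ⟩ [ a ] t ≈⋏ [ a ] t′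
  ≈-abs≢  : ∀ {a b s t} (c₁ : Atom) → a ≢ b →
            ¬ occursInΥ Υ c₁ → c₁ ∉ cs → ¬ (c₁ occursIn [ a ] s) → ¬ (c₁ occursIn [ b ] t) →
            Υ ⊢И⟨ cs ⟩ s ≈⋏ (swap a b • t) → Υ ⊢И⟨ c₁ ∷ cs ⟩ swap a c₁ ⋏ t →
            Υ ⊢И⟨ cs ⟩ [ a ] s ≈⋏ [ b ] t

-- ν chooses the new atoms c_a = ν a used to translate Δ: pairwise distinct, and
-- occurring neither in Δ nor in s, t. Values of ν outside the atoms of Δ are irrelevant.
record NewAtoms {F : Set} (Δ : FreshCtx) (s t : Term F) (ν : Atom → Atom) : Set where
  field
    distinct : ∀ {a b} → occursInΔ Δ a → occursInΔ Δ b → ν a ≡ ν b → a ≡ b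
    new-Δ    : ∀ {a} → occursInΔ Δ a → ¬ occursInΔ Δ (ν a)
    new-s    : ∀ {a} → occursInΔ Δ a → ¬ (ν a occursIn s)
    new-t    : ∀ {a} → occursInΔ Δ a → ¬ (ν a occursIn t)

[_]⋏ : FreshCtx → (Atom → Atom) → FixCtx
[ Δ ]⋏ ν = map (λ (a , X) → swap a (ν a) , X) Δ

-- `bound` may overshoot, so it is filtered down to the support.
[_]# : FixCtx → FreshCtx
[ Υ ]# = concatMap (λ (π , X) → map (_, X) (filter (λ a → ¬? (π ⟨$⟩ a ≟ a)) (bound π))) Υ

{-# OPTIONS --safe #-}

-- A context Γ of constraints a # X and a pair (Υ , cs) carry the same
-- information when (a , X) ∈ Γ exactly if a ∈ cs or a lies in the support of some
-- π with π ⋏ X ∈ Υ.  Under this correspondence π ⋏ t says that every atom of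
-- supp π is fresh for t.  Passing under a binder with a new atom c₁ adds c₁ to cs
-- on one side and c₁ # X, for the variables X of the body, on the other;
-- since c₁ does not occur in the body, these extra assumptions can be discharged again.
module Submission where

open import Defs
open import Data.List.Base using (List; []; _∷_; _++_; map; concat; tabulate)
open import Data.List.Extrema.Nat using (max; xs≤max)
open import Data.List.Membership.Propositional using (_∈_; _∉_)
open import Data.List.Membership.Propositional.Properties using (∈-++⁺ˡ; ∈-++⁺ʳ; ∈-++⁻; ∈-map⁺; ∈-map⁻; ∈-filter⁺; ∈-concat⁺′; ∈-tabulate⁺)
open import Data.List.Relation.Unary.All using (lookup)
open import Data.List.Relation.Unary.Any using (here; there)
open import Data.Nat.Base using (ℕ; suc)
open import Data.Nat.Properties using (_≟_; 1+n≰n)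
open import Data.List.Membership.DecPropositional _≟_ using (_∈?_)
open import Data.Product.Base using (_×_; _,_; ∃-syntax)
open import Data.Sum.Base using (_⊎_; inj₁; inj₂; [_,_]′)
import Data.Sum.Base as Sum
open import Function.Base using (_∘_; id)
open import Function.Bundles using (_↣_; _⇔_; mk⇔; Inverse)
open import Level using (0ℓ)
open import Relation.Binary.PropositionalEquality using (_≡_; _≢_; refl; sym; trans; cong; subst)
open import Relation.Nullary using (¬_; yes; no; contradiction)
open import Relation.Nullary.Decidable using (¬?; decidable-stable)
open import Relation.Unary using (Pred)

private
  variable
    F : Set
    Γ Γ′ : FreshCtx
    Υ : FixCtx
    cs : List Atom
    π : Perm
    a b c : Atom
    X : Var
    s t : Term F

-- Permutations

⁻¹-cancelˡ : ∀ π a → π ⁻¹ ⟨$⟩ π ⟨$⟩ a ≡ a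
⁻¹-cancelˡ π = Inverse.strictlyInverseʳ (bij π)

⁻¹-cancelʳ : ∀ π a → π ⟨$⟩ π ⁻¹ ⟨$⟩ a ≡ a
⁻¹-cancelʳ π = Inverse.strictlyInverseˡ (bij π)

⟨$⟩-injective : ∀ π → π ⟨$⟩ a ≡ π ⟨$⟩ b → a ≡ b
⟨$⟩-injective π eq =
  trans (sym (⁻¹-cancelˡ π _)) (trans (cong (π ⁻¹ ⟨$⟩_) eq) (⁻¹-cancelˡ π _))

¬supp⇒fixed : ∀ π → ¬ supp π a → π ⟨$⟩ a ≡ a
¬supp⇒fixed {a} π = decidable-stable (π ⟨$⟩ a ≟ a)

swap-left : ∀ a b → swap a b ⟨$⟩ a ≡ b
swap-left a b with a ≟ a
... | yes _   = refl
... | no  a≢a = contradiction refl a≢a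

swap-right : ∀ a b → swap a b ⟨$⟩ b ≡ a
swap-right a b with b ≟ a
... | yes b≡a = b≡a
... | no  _ with b ≟ b
...   | yes _   = refl
...   | no  b≢b = contradiction refl b≢b

swap-fixes : c ≢ a → c ≢ b → swap a b ⟨$⟩ c ≡ c
swap-fixes {c} {a} {b} c≢a c≢b = ¬supp⇒fixed (swap a b) λ c∈ →
  c∉ab (swapFun-bounded a b c c∈)
  where
  c∉ab : c ∉ a ∷ b ∷ []
  c∉ab (here c≡a)         = c≢a c≡a
  c∉ab (there (here c≡b)) = c≢b c≡b

-- Variables and atoms of terms and contexts

vars : Term F → List Var
vars (atom _)   = []
vars ([ _ ] t)  = vars t
vars (tuple ts) = concat (tabulate λ i → vars (ts i))
vars (app _ t)  = vars t
vars (_ · X)    = X ∷ []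

varOf⇒∈vars : X varOf t → X ∈ vars t
varOf⇒∈vars (in-body p)    = varOf⇒∈vars p
varOf⇒∈vars (in-tuple i p) = ∈-concat⁺′ (varOf⇒∈vars p) (∈-tabulate⁺ i)
varOf⇒∈vars (in-app p)     = varOf⇒∈vars p
varOf⇒∈vars in-susp        = here refl

varOf-•⁻ : ∀ (t : Term F) → X varOf (π • t) → X varOf t
varOf-•⁻ ([ _ ] t)  (in-body p)    = in-body (varOf-•⁻ t p)
varOf-•⁻ (tuple ts) (in-tuple i p) = in-tuple i (varOf-•⁻ (ts i) p)
varOf-•⁻ (app _ t)  (in-app p)     = in-app (varOf-•⁻ t p)
varOf-•⁻ (_ · _)    in-susp        = in-susp

-- An overestimate, since `bound π` may exceed `supp π`; the list only serves to pick an atom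
-- outside it.
atoms : Term F → List Atom
atoms (atom a)   = a ∷ []
atoms ([ a ] t)  = a ∷ atoms t
atoms (tuple ts) = concat (tabulate λ i → atoms (ts i))
atoms (app _ t)  = atoms t
atoms (π · _)    = bound π

occursIn⇒∈atoms : c occursIn t → c ∈ atoms t
occursIn⇒∈atoms in-atom              = here refl
occursIn⇒∈atoms in-bind              = here refl
occursIn⇒∈atoms (in-body p)          = there (occursIn⇒∈atoms p)
occursIn⇒∈atoms (in-tuple i p)       = ∈-concat⁺′ (occursIn⇒∈atoms p) (∈-tabulate⁺ i)
occursIn⇒∈atoms (in-app p)           = occursIn⇒∈atoms p
occursIn⇒∈atoms (in-susp {π = π} p)  = bounded π _ p

atomsΥ : FixCtx → List Atom
atomsΥ []            = []
atomsΥ ((π , _) ∷ Υ) = bound π ++ atomsΥ Υ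

occursInΥ⇒∈atomsΥ : occursInΥ Υ c → c ∈ atomsΥ Υ
occursInΥ⇒∈atomsΥ (π , _ , here refl , p) = ∈-++⁺ˡ (bounded π _ p)
occursInΥ⇒∈atomsΥ {Υ = (ρ , _) ∷ _} (π , X , there m , p) =
  ∈-++⁺ʳ (bound ρ) (occursInΥ⇒∈atomsΥ (π , X , m , p))

∃-fresh : ∀ (xs : List Atom) → ∃[ c ] c ∉ xs
∃-fresh xs = suc (max 0 xs) , λ c∈xs → 1+n≰n (lookup (xs≤max 0 xs) c∈xs)

-- Freshness

#-weaken : (∀ {b X} → (b , X) ∈ Γ → (b , X) ∈ Γ′) → Γ ⊢ a # t → Γ′ ⊢ a # t
#-weaken Γ⊆Γ′ (#-atom a≢b)   = #-atom a≢b
#-weaken Γ⊆Γ′ (#-susp m)     = #-susp (Γ⊆Γ′ m)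
#-weaken Γ⊆Γ′ (#-app p)      = #-app (#-weaken Γ⊆Γ′ p)
#-weaken Γ⊆Γ′ (#-tuple ps)   = #-tuple λ i → #-weaken Γ⊆Γ′ (ps i)
#-weaken Γ⊆Γ′ #-abs≡         = #-abs≡
#-weaken Γ⊆Γ′ (#-abs≢ a≢b p) = #-abs≢ a≢b (#-weaken Γ⊆Γ′ p)

-- An assumption on `c` could only be used at a suspension `π · X` with `π ⁻¹ ⟨$⟩ a ≡ c`; as `π`
-- fixes the non-occurring `c`, this would give `a ≡ c`.
#-strengthen : (∀ {b X} → (b , X) ∈ Γ′ → b ≢ c → (b , X) ∈ Γ) →
               a ≢ c → ¬ (c occursIn t) → Γ′ ⊢ a # t → Γ ⊢ a # t
#-strengthen h a≢c c∉t (#-atom a≢b) = #-atom a≢b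
#-strengthen h a≢c c∉t (#-susp {π} m) = #-susp (h m λ π⁻¹a≡c →
  a≢c (trans (sym (⁻¹-cancelʳ π _))
             (trans (cong (π ⟨$⟩_) π⁻¹a≡c) (¬supp⇒fixed π (c∉t ∘ in-susp)))))
#-strengthen h a≢c c∉t (#-app p) = #-app (#-strengthen h a≢c (c∉t ∘ in-app) p)
#-strengthen h a≢c c∉t (#-tuple ps) =
  #-tuple λ i → #-strengthen h a≢c (c∉t ∘ in-tuple i) (ps i)
#-strengthen h a≢c c∉t #-abs≡ = #-abs≡
#-strengthen h a≢c c∉t (#-abs≢ a≢b p) =
  #-abs≢ a≢b (#-strengthen h a≢c (c∉t ∘ in-body) p)

#-•⁺ : ∀ π → Γ ⊢ a # t → Γ ⊢ π ⟨$⟩ a # (π • t)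
#-•⁺ π (#-atom a≢b) = #-atom (a≢b ∘ ⟨$⟩-injective π)
#-•⁺ {Γ = Γ} π (#-susp {ρ} {X} m) =
  #-susp (subst (λ b → (ρ ⁻¹ ⟨$⟩ b , X) ∈ Γ) (sym (⁻¹-cancelˡ π _)) m)
#-•⁺ π (#-app p) = #-app (#-•⁺ π p)
#-•⁺ π (#-tuple ps) = #-tuple λ i → #-•⁺ π (ps i)
#-•⁺ π #-abs≡ = #-abs≡
#-•⁺ π (#-abs≢ a≢b p) = #-abs≢ (a≢b ∘ ⟨$⟩-injective π) (#-•⁺ π p)

#-•⁻ : ∀ π (t : Term F) → Γ ⊢ a # (π • t) → Γ ⊢ π ⁻¹ ⟨$⟩ a # t
#-•⁻ π (atom b) (#-atom a≢πb) =
  #-atom λ π⁻¹a≡b → a≢πb (trans (sym (⁻¹-cancelʳ π _)) (cong (π ⟨$⟩_) π⁻¹a≡b))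
#-•⁻ {Γ = Γ} π ([ b ] t) #-abs≡ =
  subst (λ x → Γ ⊢ x # [ b ] t) (sym (⁻¹-cancelˡ π b)) #-abs≡
#-•⁻ π ([ b ] t) (#-abs≢ a≢πb p) =
  #-abs≢ (λ π⁻¹a≡b → a≢πb (trans (sym (⁻¹-cancelʳ π _)) (cong (π ⟨$⟩_) π⁻¹a≡b)))
         (#-•⁻ π t p)
#-•⁻ π (tuple ts) (#-tuple ps) = #-tuple λ i → #-•⁻ π (ts i) (ps i)
#-•⁻ π (app _ t)  (#-app p)    = #-app (#-•⁻ π t p)
#-•⁻ π (_ · _)    (#-susp m)   = #-susp m

#-swap⁺ : c ≢ a → c ≢ b → Γ ⊢ c # t → Γ ⊢ c # (swap a b • t)
#-swap⁺ {a = a} {b = b} {Γ = Γ} {t = t} c≢a c≢b p =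
  subst (λ x → Γ ⊢ x # (swap a b • t)) (swap-fixes c≢a c≢b) (#-•⁺ (swap a b) p)

#-swap⁻ : c ≢ a → c ≢ b → Γ ⊢ c # (swap a b • t) → Γ ⊢ c # t
#-swap⁻ {a = a} {b = b} {Γ = Γ} {t = t} c≢a c≢b p =
  subst (λ x → Γ ⊢ x # t) (swap-fixes c≢a c≢b) (#-•⁻ (swap a b) t p)

#-body : a ≢ b → Γ ⊢ a # [ b ] t → Γ ⊢ a # t
#-body a≢b #-abs≡       = contradiction refl a≢b
#-body a≢b (#-abs≢ _ p) = p

infix 6 _#vars_
-- Contexts are finite, so `c` is declared fresh only for the variables of `t`, the only ones that a
-- derivation about `t` consults.
_#vars_ : Atom → Term F → FreshCtx
c #vars t = map (c ,_) (vars t)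

∈-#vars⁻ : ∀ (t : Term F) → (b , X) ∈ c #vars t → b ≡ c
∈-#vars⁻ {c = c} t m with _ , _ , refl ← ∈-map⁻ (c ,_) m = refl

∈-#vars⁺ : X varOf t → (c , X) ∈ c #vars t
∈-#vars⁺ {c = c} p = ∈-map⁺ (c ,_) (varOf⇒∈vars p)

-- At a suspension `π` fixes `c`, so the constraint that the rule asks for is on `c` itself.
nonoccurring⇒# : ∀ (t : Term F) → ¬ (c occursIn t) →
                 (∀ {X} → X varOf t → (c , X) ∈ Γ) → Γ ⊢ c # t
nonoccurring⇒# (atom _) c∉t h = #-atom λ { refl → c∉t in-atom }
nonoccurring⇒# ([ _ ] t) c∉t h =
  #-abs≢ (λ { refl → c∉t in-bind }) (nonoccurring⇒# t (c∉t ∘ in-body) (h ∘ in-body))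
nonoccurring⇒# (tuple ts) c∉t h =
  #-tuple λ i → nonoccurring⇒# (ts i) (c∉t ∘ in-tuple i) (h ∘ in-tuple i)
nonoccurring⇒# (app _ t) c∉t h = #-app (nonoccurring⇒# t (c∉t ∘ in-app) (h ∘ in-app))
nonoccurring⇒# {Γ = Γ} (π · X) c∉t h =
  #-susp (subst (λ x → (x , X) ∈ Γ) (sym π⁻¹c≡c) (h in-susp))
  where
  π⁻¹c≡c : π ⁻¹ ⟨$⟩ _ ≡ _
  π⁻¹c≡c = trans (cong (π ⁻¹ ⟨$⟩_) (sym (¬supp⇒fixed π (c∉t ∘ in-susp)))) (⁻¹-cancelˡ π _)

#vars⇒# : ∀ (t : Term F) → ¬ (c occursIn t) → c #vars t ++ Γ ⊢ c # t
#vars⇒# t c∉t = nonoccurring⇒# t c∉t λ X∈t → ∈-++⁺ˡ (∈-#vars⁺ X∈t)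

#vars-discharge : ∀ (t : Term F) → a ≢ c → ¬ (c occursIn t) → c #vars t ++ Γ ⊢ a # t → Γ ⊢ a # t
#vars-discharge {c = c} {Γ = Γ} t = #-strengthen drop
  where
  drop : ∀ {b X} → (b , X) ∈ c #vars t ++ Γ → b ≢ c → (b , X) ∈ Γ
  drop m b≢c = [ (λ m′ → contradiction (∈-#vars⁻ t m′) b≢c) , id ]′ (∈-++⁻ (c #vars t) m)

-- Correspondence of contexts

Supported : FixCtx → List Atom → Var → Pred Atom 0ℓ
Supported Υ cs X c = c ∈ cs ⊎ suppPerm Υ X c

Sound : FixCtx → List Atom → FreshCtx → Set
Sound Υ cs Γ = ∀ {c X} → (c , X) ∈ Γ → Supported Υ cs X c

-- Restricted to the variables of `t`: an atom of `cs` is supported at every variable, and a finite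
-- `Γ` cannot list them all.
Complete : FixCtx → List Atom → Term F → FreshCtx → Set
Complete Υ cs t Γ = ∀ {c X} → X varOf t → Supported Υ cs X c → (c , X) ∈ Γ

Sound-∷ : ∀ (t : Term F) → Sound Υ cs Γ → Sound Υ (c ∷ cs) (c #vars t ++ Γ)
Sound-∷ {c = c} t sound m with ∈-++⁻ (c #vars t) m
... | inj₁ m′ = inj₁ (here (∈-#vars⁻ t m′))
... | inj₂ m′ = Sum.map₁ there (sound m′)

Complete-∷ : ∀ (t : Term F) → Complete Υ cs t Γ → Complete Υ (c ∷ cs) t (c #vars t ++ Γ)
Complete-∷ t compl X∈t (inj₁ (here refl)) = ∈-++⁺ˡ (∈-#vars⁺ X∈t)
Complete-∷ {c = c} t compl X∈t (inj₁ (there m)) = ∈-++⁺ʳ (c #vars t) (compl X∈t (inj₁ m))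
Complete-∷ {c = c} t compl X∈t (inj₂ p) = ∈-++⁺ʳ (c #vars t) (compl X∈t (inj₂ p))

∖⊆⇒Supported : ∀ {P : Pred Atom 0ℓ} → (∀ {c} → P c × c ∉ cs → suppPerm Υ X c) →
               P c → Supported Υ cs X c
∖⊆⇒Supported {cs = cs} {c = c} h p with c ∈? cs
... | yes c∈cs = inj₁ c∈cs
... | no  c∉cs = inj₂ (h (p , c∉cs))

Supported⇒suppPerm : c ∉ cs → Supported Υ cs X c → suppPerm Υ X c
Supported⇒suppPerm c∉cs = [ (λ c∈cs → contradiction c∈cs c∉cs) , id ]′

-- From fixed points to freshness

⋏⇒# : ∀ (t : Term F) → Complete Υ cs t Γ → Υ ⊢И⟨ cs ⟩ π ⋏ t → supp π a → Γ ⊢ a # t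
⋏⇒# _ compl (⋏-atom πb≡b) a∈π = #-atom λ { refl → a∈π πb≡b }
⋏⇒# {π = π} _ compl (⋏-susp {π′} h) a∈π =
  -- The conjugate moves `π′ ⁻¹ ⟨$⟩ a`, because `π` moves `a`.
  #-susp (compl in-susp (∖⊆⇒Supported h λ eq →
    a∈π (trans (cong (π ⟨$⟩_) (sym (⁻¹-cancelʳ π′ _))) (⟨$⟩-injective (π′ ⁻¹) eq))))
⋏⇒# _ compl (⋏-app p) a∈π = #-app (⋏⇒# _ (compl ∘ in-app) p a∈π)
⋏⇒# _ compl (⋏-tuple ps) a∈π = #-tuple λ i → ⋏⇒# _ (compl ∘ in-tuple i) (ps i) a∈π
⋏⇒# {a = a} ([ b ] t) compl (⋏-abs c₁ _ _ c₁∉π c₁∉bt p) a∈π with a ≟ b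
... | yes refl = #-abs≡
-- Since `π` moves `a` but not `c₁`, these two differ; so the swapping fixes `a` and can be stripped
-- off before `c₁` is discharged.
... | no  a≢b  = #-abs≢ a≢b (#vars-discharge t a≢c₁ (c₁∉bt ∘ in-body)
                   (#-swap⁻ a≢b a≢c₁
                     (⋏⇒# _ (Complete-∷ t (compl ∘ in-body) ∘ varOf-•⁻ t) p a∈π)))
  where
  a≢c₁ : a ≢ c₁
  a≢c₁ refl = c₁∉π a∈π

-- Induction on the derivation. For distinct binders, the side condition `a # t` is `⋏⇒#` at the
-- atom `a`, which `swap a c₁` moves.
≈⋏⇒≈α : ∀ (s t : Term F) → Complete Υ cs s Γ → Complete Υ cs t Γ →
        Υ ⊢И⟨ cs ⟩ s ≈⋏ t → Γ ⊢ s ≈α t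
≈⋏⇒≈α _ _ compl-s compl-t ≈-atom = ≈-atom
≈⋏⇒≈α _ _ compl-s compl-t (≈-susp {π} {π′} h) = ≈-susp λ a πa≢π′a →
  -- If `π′ ⁻¹ ∘ₚ π` fixed `a`, then `π` and `π′` would agree at `a`.
  compl-s in-susp (∖⊆⇒Supported h λ eq →
    πa≢π′a (trans (sym (⁻¹-cancelʳ π′ _)) (cong (π′ ⟨$⟩_) eq)))
≈⋏⇒≈α _ _ compl-s compl-t (≈-app p) = ≈-app (≈⋏⇒≈α _ _ (compl-s ∘ in-app) (compl-t ∘ in-app) p)
≈⋏⇒≈α _ _ compl-s compl-t (≈-tuple ps) =
  ≈-tuple λ i → ≈⋏⇒≈α _ _ (compl-s ∘ in-tuple i) (compl-t ∘ in-tuple i) (ps i)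
≈⋏⇒≈α _ _ compl-s compl-t (≈-abs≡ p) = ≈-abs≡ (≈⋏⇒≈α _ _ (compl-s ∘ in-body) (compl-t ∘ in-body) p)
≈⋏⇒≈α ([ a ] s) ([ b ] t) compl-s compl-t (≈-abs≢ c₁ a≢b _ _ c₁∉as c₁∉bt p q) =
  ≈-abs≢ a≢b
    (≈⋏⇒≈α _ _ (compl-s ∘ in-body) (compl-t ∘ in-body ∘ varOf-•⁻ t) p)
    (#vars-discharge t a≢c₁ (c₁∉bt ∘ in-body)
      (⋏⇒# _ (Complete-∷ t (compl-t ∘ in-body)) q
        λ eq → a≢c₁ (trans (sym eq) (swap-left a c₁))))
  where
  a≢c₁ : a ≢ c₁
  a≢c₁ refl = c₁∉as in-bind

-- From freshness to fixed points

-- The premise of ⋏-abs is about a permuted body, which is not a subterm; and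
-- (π ∘ₚ ρ) • t ≡ π • ρ • t is not provable without function extensionality. Recursion on this
-- accessibility predicate replaces recursion on terms.
data •-Acc {F : Set} : Term F → Set where
  acc-atom  : •-Acc (atom a)
  acc-abs   : (∀ π → •-Acc (π • t)) → •-Acc ([ a ] t)
  acc-tuple : ∀ {n ts} → (∀ i → •-Acc (ts i)) → •-Acc (tuple {n = n} ts)
  acc-app   : ∀ {f} → •-Acc t → •-Acc (app f t)
  acc-susp  : •-Acc (π · X)

-- For an abstraction, `f π` is already a smaller proof about `π • t`, so recursion on it reaches
-- `ρ • π • t` without composing permutations.
•-acc-closed : ∀ π → •-Acc t → •-Acc (π • t)
•-acc-closed π acc-atom       = acc-atom
•-acc-closed π (acc-abs f)    = acc-abs λ ρ → •-acc-closed ρ (f π)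
•-acc-closed π (acc-tuple fs) = acc-tuple λ i → •-acc-closed π (fs i)
•-acc-closed π (acc-app r)    = acc-app (•-acc-closed π r)
•-acc-closed π acc-susp       = acc-susp

•-acc : ∀ (t : Term F) → •-Acc t
•-acc (atom _)   = acc-atom
•-acc ([ _ ] t)  = acc-abs λ π → •-acc-closed π (•-acc t)
•-acc (tuple ts) = acc-tuple λ i → •-acc (ts i)
•-acc (app _ t)  = acc-app (•-acc t)
•-acc (_ · _)    = acc-susp

-- The hypothesis is a family of freshness derivations, one for each atom of `supp π` and none if
-- `π` is the identity, so there is no single derivation to recurse on.
#⇒⋏ : •-Acc t → Sound Υ cs Γ → (∀ {a} → supp π a → Γ ⊢ a # t) → Υ ⊢И⟨ cs ⟩ π ⋏ t
#⇒⋏ {π = π} (acc-atom {a}) sound fr = ⋏-atom (¬supp⇒fixed π λ a∈π → irrefl (fr a∈π))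
  where
  irrefl : ¬ (Γ ⊢ a # atom {F} a)
  irrefl (#-atom a≢a) = a≢a refl
#⇒⋏ {Γ = Γ} (acc-susp {ρ} {X}) sound fr = ⋏-susp λ { {b} (b∈ , b∉cs) →
  -- If the conjugate moves `b`, then `π` moves `ρ ⟨$⟩ b`; freshness of that atom for `ρ · X` rests
  -- on the constraint on `b`.
  Supported⇒suppPerm b∉cs (sound (subst (λ x → (x , X) ∈ Γ) (⁻¹-cancelˡ ρ b)
    (susp⁻ (fr λ eq → b∈ (trans (cong (ρ ⁻¹ ⟨$⟩_) eq) (⁻¹-cancelˡ ρ b)))))) }
  where
  susp⁻ : ∀ {b} → Γ ⊢ b # ρ · X → (ρ ⁻¹ ⟨$⟩ b , X) ∈ Γ
  susp⁻ (#-susp m) = m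
#⇒⋏ (acc-app r) sound fr = ⋏-app (#⇒⋏ r sound λ a∈π → app⁻ (fr a∈π))
  where
  app⁻ : ∀ {f} → Γ ⊢ b # app f t → Γ ⊢ b # t
  app⁻ (#-app p) = p
#⇒⋏ (acc-tuple rs) sound fr = ⋏-tuple λ i → #⇒⋏ (rs i) sound λ a∈π → tuple⁻ (fr a∈π) i
  where
  tuple⁻ : ∀ {n ts} → Γ ⊢ b # tuple {n = n} ts → ∀ i → Γ ⊢ b # ts i
  tuple⁻ (#-tuple ps) = ps
#⇒⋏ {Υ = Υ} {cs} {Γ} {π} (acc-abs {t} {a} f) sound fr
  -- The four lists match the four side conditions of `⋏-abs`, in order.
  with c₁ , c₁∉ ← ∃-fresh (atomsΥ Υ ++ cs ++ bound π ++ atoms ([ a ] t)) =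
  ⋏-abs c₁
    (c₁∉ ∘ ∈-++⁺ˡ ∘ occursInΥ⇒∈atomsΥ)
    (c₁∉ ∘ ∈-++⁺ʳ (atomsΥ Υ) ∘ ∈-++⁺ˡ)
    c₁∉π
    c₁∉at
    (#⇒⋏ (f (swap a c₁)) (Sound-∷ t sound) fr′)
  where
  c₁∉π : ¬ supp π c₁
  c₁∉π = c₁∉ ∘ ∈-++⁺ʳ (atomsΥ Υ) ∘ ∈-++⁺ʳ cs ∘ ∈-++⁺ˡ ∘ bounded π c₁

  c₁∉at : ¬ (c₁ occursIn [ a ] t)
  c₁∉at = c₁∉ ∘ ∈-++⁺ʳ (atomsΥ Υ) ∘ ∈-++⁺ʳ cs ∘ ∈-++⁺ʳ (bound π) ∘ occursIn⇒∈atoms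

  fr′ : ∀ {b} → supp π b → c₁ #vars t ++ Γ ⊢ b # (swap a c₁ • t)
  fr′ {b} b∈π with b ≟ a
  -- Freshness of `a` for `[ a ] t` says nothing about `t`; but the swapping carries `c₁`, fresh for
  -- `t` by the added constraints, to `a`.
  ... | yes refl = subst (λ x → c₁ #vars t ++ Γ ⊢ x # (swap b c₁ • t)) (swap-right b c₁)
                     (#-•⁺ (swap b c₁) (#vars⇒# t (c₁∉at ∘ in-body)))
  ... | no  b≢a  = #-swap⁺ b≢a (λ { refl → c₁∉π b∈π })
                     (#-weaken (∈-++⁺ʳ (c₁ #vars t)) (#-body b≢a (fr b∈π)))

≈α⇒≈⋏ : Sound Υ cs Γ → Γ ⊢ s ≈α t → Υ ⊢И⟨ cs ⟩ s ≈⋏ t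
≈α⇒≈⋏ sound ≈-atom = ≈-atom
≈α⇒≈⋏ sound (≈-susp {π} {π′} h) = ≈-susp λ { {a} (a∈ , a∉cs) →
  Supported⇒suppPerm a∉cs (sound (h a λ eq →
    a∈ (trans (cong (π′ ⁻¹ ⟨$⟩_) eq) (⁻¹-cancelˡ π′ a)))) }
≈α⇒≈⋏ sound (≈-app p) = ≈-app (≈α⇒≈⋏ sound p)
≈α⇒≈⋏ sound (≈-tuple ps) = ≈-tuple λ i → ≈α⇒≈⋏ sound (ps i)
≈α⇒≈⋏ sound (≈-abs≡ p) = ≈-abs≡ (≈α⇒≈⋏ sound p)
≈α⇒≈⋏ {Υ = Υ} {cs} {Γ} sound (≈-abs≢ {a} {b} {s} {t} a≢b p q)
  with c₁ , c₁∉ ← ∃-fresh (atomsΥ Υ ++ cs ++ atoms ([ a ] s) ++ atoms ([ b ] t)) =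
  ≈-abs≢ c₁ a≢b
    (c₁∉ ∘ ∈-++⁺ˡ ∘ occursInΥ⇒∈atomsΥ)
    (c₁∉ ∘ ∈-++⁺ʳ (atomsΥ Υ) ∘ ∈-++⁺ˡ)
    (c₁∉ ∘ ∈-++⁺ʳ (atomsΥ Υ) ∘ ∈-++⁺ʳ cs ∘ ∈-++⁺ˡ ∘ occursIn⇒∈atoms)
    c₁∉bt
    (≈α⇒≈⋏ sound p)
    -- The swapping moves at most `a`, fresh for `t` by the premise `q`, and `c₁`, fresh for `t` by
    -- the added constraints.
    (#⇒⋏ (•-acc t) (Sound-∷ t sound) λ {x} x∈ → fr (swapFun-bounded a c₁ x x∈))
  where
  c₁∉bt : ¬ (c₁ occursIn [ b ] t)
  c₁∉bt = c₁∉ ∘ ∈-++⁺ʳ (atomsΥ Υ) ∘ ∈-++⁺ʳ cs ∘ ∈-++⁺ʳ (atoms ([ a ] s)) ∘ occursIn⇒∈atoms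

  fr : ∀ {x} → x ∈ a ∷ c₁ ∷ [] → c₁ #vars t ++ Γ ⊢ x # t
  fr (here refl)         = #-weaken (∈-++⁺ʳ (c₁ #vars t)) q
  fr (there (here refl)) = #vars⇒# t (c₁∉bt ∘ in-body)

-- The translations of contexts

-- The swapping of `a` with `ν a` has `a` in its support once the two differ. It then moves `ν a`
-- too, so the translation may support more than `Δ` lists; soundness allows this.
[]⋏-sound : ∀ {Δ ν} → (∀ {a} → occursInΔ Δ a → ν a ≢ a) → Sound ([ Δ ]⋏ ν) [] Δ
[]⋏-sound {ν = ν} ν-moves {a} {X} m =
  inj₂ (swap a (ν a) , ∈-map⁺ _ m , λ eq → ν-moves (X , m) (trans (sym (swap-left a (ν a))) eq))

suppPerm⇒∈[]# : suppPerm Υ X c → (c , X) ∈ [ Υ ]#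
suppPerm⇒∈[]# {Υ = (π , X) ∷ _} (_ , here refl , c∈π) =
  ∈-++⁺ˡ (∈-map⁺ (_, X) (∈-filter⁺ (λ a → ¬? (π ⟨$⟩ a ≟ a)) (bounded π _ c∈π) c∈π))
suppPerm⇒∈[]# {Υ = _ ∷ _} (π , there m , c∈π) = ∈-++⁺ʳ _ (suppPerm⇒∈[]# (π , m , c∈π))

[]#-complete : ∀ {Δ} {t : Term F} → (∀ c X → c ∈ cs → X varOf t → Δ ⊢ c # (var {F} X)) →
               Complete Υ cs t ([ Υ ]# ++ Δ)
-- Inverting freshness for `idₚ · X` yields `(c , X) ∈ Δ`, since `idₚ ⁻¹` computes to the identity.
[]#-complete {Υ = Υ} fr X∈t (inj₁ c∈cs) with #-susp m ← fr _ _ c∈cs X∈t = ∈-++⁺ʳ [ Υ ]# m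
[]#-complete fr X∈t (inj₂ c∈Υ) = ∈-++⁺ˡ (suppPerm⇒∈[]# c∈Υ)

theorem3p16 : (F : Set) → F ↣ ℕ →
    (∀ (s t : Term F) → Ground s → Ground t → ([] ⊢ s ≈α t) ⇔ ([] ⊢И⟨ [] ⟩ s ≈⋏ t))
    × (∀ (s t : Term F) →
    (∀ (Δ : FreshCtx) (ν : Atom → Atom) → NewAtoms Δ s t ν →
    Δ ⊢ s ≈α t → [ Δ ]⋏ ν ⊢И⟨ [] ⟩ s ≈⋏ t)
    × (∀ (Υ : FixCtx) (cs : List Atom) → Υ ⊢И⟨ cs ⟩ s ≈⋏ t →
    ∀ (Δ : FreshCtx) →
    (∀ (c : Atom) (X : Var) → c ∈ cs → (X varOf s) ⊎ (X varOf t) →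
    Δ ⊢ c # (var {F} X)) →
    ([ Υ ]# ++ Δ) ⊢ s ≈α t))
theorem3p16 F _ =
    -- All contexts and `cs` are empty, so both halves of the correspondence hold vacuously.
    (λ s t _ _ → mk⇔ (≈α⇒≈⋏ λ ()) (≈⋏⇒≈α s t (λ { _ (inj₁ ()) ; _ (inj₂ (_ , () , _)) })
                                              (λ { _ (inj₁ ()) ; _ (inj₂ (_ , () , _)) })))
  , λ s t →
      (λ Δ ν new → ≈α⇒≈⋏ ([]⋏-sound λ {a} a∈Δ νa≡a →
         -- If `ν a` were `a`, it would occur in `Δ`.
         NewAtoms.new-Δ new a∈Δ (subst (occursInΔ Δ) (sym νa≡a) a∈Δ)))
    , (λ Υ cs p Δ fr → ≈⋏⇒≈α s t ([]#-complete λ c X c∈cs X∈s → fr c X c∈cs (inj₁ X∈s))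
                                 ([]#-complete λ c X c∈cs X∈t → fr c X c∈cs (inj₂ X∈t)) p)
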